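{- Let $H=(E,\{X_i:i\in[n]\})$ be a hypergraph such that $|X_i\cap X_j|\le1$ for all distinct $i,j\in[n]$, the line graph $G_H$ is complete, and for all distinct $p,q\in[n]$ there are elements $a\in X_p$ and $b\in X_q$ such that no $i\in[n]$ has $\{a,b\}\subseteq X_i$. Let $\rho(A)=\sum_{i=1}^n\min\{|A\cap X_i|,1\}$ for $A\subseteq E$. Let $\sigma$ be any polymatroid on $E$ with $\sigma(A)=\rho(A)$ whenever either $|A|\le2$, or $|A|=3$ and $A\subseteq X_i$ for some $i\in[n]$. If $\sigma(E)<n$, then $\sigma$ is indecomposable. In particular, the truncation $T(\rho,s)$ is indecomposable whenever $$\max\{\rho(A): |A|\le2\text{ or }A\text{ is a }3\text{ -element subset of a hyperedge}\}\le s<n.$$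
   Context: A polymatroid on a finite set $E$ is a function $\rho:2^E\to\mathbb{Z}$ that is normalized, non-decreasing and submodular. A hypergraph is $H=(E,\mathcal{E})$ with $E$ finite and $\mathcal{E}=\{X_i:i\in[n]\}$ a set of nonempty subsets of $E$. The line graph $G_H$ has vertex set $[n]$ with $ij$ an edge iff $i\ne j$ and $X_i\cap X_j\ne\emptyset$. A polymatroid is indecomposable if it cannot be written as a sum $r_{M_1}+\cdots+r_{M_k}$ of rank functions of matroids on its ground set for any $k$. The truncation $T(\rho,s)$ is the polymatroid $X\mapsto\min\{\rho(X),s\}$. -}

module Defs where

open import Data.Fin using (Fin)
open import Data.Fin.Subset
  using (Subset; inside; outside; _∈_; _⊆_; _∩_; _∪_; ⊥; ∣_∣; Nonempty)
open import Data.Fin.Subset.Properties using (_⊆?_)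
open import Data.Fin.Properties using (any?)
open import Data.Integer using (ℤ; +_; _+_; _≤_; _⊓_)
open import Data.Integer.Properties using (+-0-commutativeMonoid; ≤-totalOrder)
open import Data.List using (List; []; _∷_; _++_; map; filter)
open import Data.List.Extrema ≤-totalOrder using (max)
open import Data.Nat as ℕ using (ℕ; zero; suc)
open import Data.Product using (∃-syntax; Σ-syntax; _×_)
open import Data.Sum using (_⊎_)
open import Data.Vec using ([]; _∷_)
open import Algebra.Properties.CommutativeMonoid.Sum +-0-commutativeMonoid using (sum)
open import Function.Definitions using (Injective)
open import Relation.Binary.PropositionalEquality using (_≡_; _≢_)
open import Relation.Nullary using (¬_; Dec)
open import Relation.Nullary.Decidable using (_⊎-dec_; _×-dec_)

-- The finite ground set E with m elements is Fin m throughout.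

record IsPolymatroid {m : ℕ} (ρ : Subset m → ℤ) : Set where
  field
    normalized : ρ ⊥ ≡ + 0
    monotone   : ∀ A B → A ⊆ B → ρ A ≤ ρ B
    submodular : ∀ A B → ρ (A ∪ B) + ρ (A ∩ B) ≤ ρ A + ρ B

-- A matroid, presented by the rank axioms: a polymatroid whose value on
-- each set is at most the size of that set.
record Matroid (m : ℕ) : Set where
  field
    rank          : Subset m → ℤ
    isPolymatroid : IsPolymatroid rank
    rank≤size     : ∀ A → rank A ≤ + ∣ A ∣

Decomposable : {m : ℕ} → (Subset m → ℤ) → Set
Decomposable {m} ρ =
  ∃[ k ] Σ[ M ∈ (Fin k → Matroid m) ] (∀ A → ρ A ≡ sum (λ i → Matroid.rank (M i) A))

-- Only meaningful for polymatroids.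
Indecomposable : {m : ℕ} → (Subset m → ℤ) → Set
Indecomposable ρ = ¬ Decomposable ρ

truncate : {m : ℕ} → (Subset m → ℤ) → ℤ → Subset m → ℤ
truncate ρ s A = ρ A ⊓ s

-- The hyperedges form a set, so the indexing by Fin n has no repetitions.
record Hypergraph (m n : ℕ) : Set where
  field
    edge     : Fin n → Subset m
    nonempty : ∀ i → Nonempty (edge i)
    distinct : Injective _≡_ _≡_ edge

module _ {m n : ℕ} (H : Hypergraph m n) where
  open Hypergraph H

  LineGraphAdjacent : Fin n → Fin n → Set
  LineGraphAdjacent i j = i ≢ j × Nonempty (edge i ∩ edge j)

  LineGraphComplete : Set
  LineGraphComplete = ∀ i j → i ≢ j → LineGraphAdjacent i j

  hypergraphRank : Subset m → ℤ
  hypergraphRank A = sum (λ i → + (∣ A ∩ edge i ∣ ℕ.⊓ 1))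

  Small : Subset m → Set
  Small A = (∣ A ∣ ℕ.≤ 2) ⊎ (∣ A ∣ ≡ 3 × (∃[ i ] A ⊆ edge i))

  small? : (A : Subset m) → Dec (Small A)
  small? A = (∣ A ∣ ℕ.≤? 2) ⊎-dec ((∣ A ∣ ℕ.≟ 3) ×-dec any? (λ i → A ⊆? edge i))

subsets : (m : ℕ) → List (Subset m)
subsets zero    = [] ∷ []
subsets (suc m) = map (outside ∷_) (subsets m) ++ map (inside ∷_) (subsets m)

-- The first argument of max is an initial value.  Since ⊥ is itself small,
-- it does not enlarge the family over which the maximum is taken.
maxSmallRank : {m n : ℕ} → Hypergraph m n → ℤ
maxSmallRank {m} H =
  max (hypergraphRank H ⊥) (map (hypergraphRank H) (filter (small? H) (subsets m)))

{-# OPTIONS --safe #-}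

-- Suppose σ = Σₖ rₖ with matroid ranks rₖ.  Distinct a, b lie in a common
-- hyperedge iff σ{a,b} < σ{a} + σ{b}, and then the defect is exactly 1, so a and
-- b are parallel in exactly one summand.  The values on triples force the three
-- pairs of a triple in Xᵢ to be parallel in the same summand; hence some summand
-- k(i) has all of Xᵢ inside one parallel class.  If k(p) = k(q) with p ≠ q, the
-- common element of Xₚ and X_q makes all of Xₚ ∪ X_q one parallel class,
-- contradicting the separation hypothesis.  So k is injective and σ(E) ≥ n.
module Submission where

open import Defs
open import Data.Fin using (Fin; zero; suc; punchIn; punchOut)
open import Data.Fin.Properties as Finₚ
  using (any?; punchInᵢ≢i; punchOut-injective; punchIn-punchOut)
open import Data.Fin.Subset
  using (Subset; inside; outside; _∈_; _∉_; _⊆_; _∩_; _∪_; ⊤; ⊥; ⁅_⁆; ∣_∣; Empty)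
open import Data.Fin.Subset.Properties
open import Data.Integer
  using (ℤ; +_; _+_; -_; _≤_; _<_; _⊓_; 0ℤ; 1ℤ; +≤+)
open import Data.Integer.Properties as ℤₚ using (module ≤-Reasoning)
open import Data.Integer.Tactic.RingSolver using (solve)
open import Data.List as List using ([]; _∷_)
open import Data.List.Extrema ℤₚ.≤-totalOrder using (⊥≤max; xs≤max)
import Data.List.Membership.Propositional as ListMem
open import Data.List.Membership.Propositional.Properties
  using (∈-++⁺ˡ; ∈-++⁺ʳ; ∈-map⁺; ∈-filter⁺)
open import Data.List.Relation.Unary.All as All using ()
open import Data.List.Relation.Unary.Any using (here)
open import Data.Nat as ℕ using (ℕ; zero; suc; z≤n; s≤s)
import Data.Nat.Properties as ℕₚ
open import Data.Product as Product using (∃-syntax; _×_; _,_; proj₁; proj₂)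
open import Data.Sum using (inj₁; inj₂; [_,_]′)
open import Data.Vec as Vec using ()
open import Algebra.Properties.CommutativeMonoid.Sum ℤₚ.+-0-commutativeMonoid
  using (sum; sum-remove; sum-cong-≗; sum-replicate-zero; ∑-distrib-+)
open import Function using (_∘_)
open import Function.Definitions using (Injective)
open import Relation.Binary.PropositionalEquality
  using (_≡_; _≢_; refl; sym; trans; cong; cong₂; subst; subst₂; ≢-sym)
open import Relation.Nullary using (¬_; yes; no; contradiction)

open IsPolymatroid

-- Linear arithmetic over ℤ: with a ≤ b the sum of the hypotheses, the
-- equation certifies y - x = b - a.
≤-certificate : ∀ {a b x y} → a ≤ b → x + b ≡ y + a → x ≤ y
≤-certificate {a} {b} {x} {y} a≤b eq = subst₂ _≤_ (cancel x) (cancel y)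
  (ℤₚ.+-monoˡ-≤ (- b) (ℤₚ.≤-trans (ℤₚ.≤-reflexive eq) (ℤₚ.+-monoʳ-≤ y a≤b)))
  where
  cancel : ∀ z → z + b + - b ≡ z
  cancel z = trans (ℤₚ.+-assoc z b (- b))
    (trans (cong (_+_ z) (ℤₚ.+-inverseʳ b)) (ℤₚ.+-identityʳ z))

-- Over the integers strictness is worth a full unit. In this form it can enter `≤-certificate`, and
-- strict gains in a sum can be counted.
<⇒1+≤ : ∀ {x y} → x < y → 1ℤ + x ≤ y
<⇒1+≤ = ℤₚ.i<j⇒suc[i]≤j

1+≤⇒< : ∀ {x y} → 1ℤ + x ≤ y → x < y
1+≤⇒< = ℤₚ.suc[i]≤j⇒i<j

-- Finite sums of integers

sum-mono : ∀ {k} {f g : Fin k → ℤ} → (∀ i → f i ≤ g i) → sum f ≤ sum g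
sum-mono {zero}  f≤g = ℤₚ.≤-refl
sum-mono {suc k} f≤g = ℤₚ.+-mono-≤ (f≤g zero) (sum-mono (f≤g ∘ suc))

sum-<⇒∃< : ∀ {k} (f g : Fin k → ℤ) → sum f < sum g → ∃[ i ] f i < g i
sum-<⇒∃< f g Σf<Σg with any? (λ i → f i ℤₚ.<? g i)
... | yes found = found
... | no  none  =
  contradiction (sum-mono (λ i → ℤₚ.≮⇒≥ (none ∘ (i ,_)))) (ℤₚ.<⇒≱ Σf<Σg)

-- Induction on `n`: removing the index `ι zero` from both sums gains at least one unit, and
-- `punchOut` reindexes the remaining strict positions injectively.
sum-mono-injective : ∀ {n k} {f g : Fin k → ℤ} → (∀ i → f i ≤ g i) →
  (ι : Fin n → Fin k) → Injective _≡_ _≡_ ι → (∀ i → f (ι i) < g (ι i)) →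
  sum f + + n ≤ sum g
sum-mono-injective {zero} f≤g ι inj strict =
  ℤₚ.≤-trans (ℤₚ.≤-reflexive (ℤₚ.+-identityʳ _)) (sum-mono f≤g)
sum-mono-injective {suc n} {zero} f≤g ι inj strict with ι zero
... | ()
sum-mono-injective {suc n} {suc k} {f} {g} f≤g ι inj strict =
  subst₂ (λ x y → x + + suc n ≤ y) (sym (sum-remove f)) (sym (sum-remove g))
    (combine (+ n) (f i₀) (g i₀) _ _ (<⇒1+≤ (strict zero))
      (sum-mono-injective (f≤g ∘ punchIn i₀) ι′ ι′-injective ι′-strict))
  where
  i₀ = ι zero
  i₀≢ : ∀ j → i₀ ≢ ι (suc j)
  i₀≢ j eq with inj eq
  ... | ()
  ι′ : Fin n → Fin k
  ι′ j = punchOut (i₀≢ j)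
  ι′-injective : Injective _≡_ _≡_ ι′
  ι′-injective eq = Finₚ.suc-injective (inj (punchOut-injective (i₀≢ _) (i₀≢ _) eq))
  ι′-strict : ∀ j → f (punchIn i₀ (ι′ j)) < g (punchIn i₀ (ι′ j))
  ι′-strict j =
    subst (λ l → f l < g l) (sym (punchIn-punchOut (i₀≢ j))) (strict (suc j))
  combine : ∀ n x y s t → 1ℤ + x ≤ y → s + n ≤ t → x + s + (1ℤ + n) ≤ y + t
  combine n x y s t p q = ≤-certificate (ℤₚ.+-mono-≤ p q) (solve (n ∷ x ∷ y ∷ s ∷ t ∷ []))

sum-mono-< : ∀ {k} {f g : Fin k → ℤ} → (∀ i → f i ≤ g i) →
  ∀ j → f j < g j → sum f < sum g
sum-mono-< {f = f} f≤g j fj<gj = 1+≤⇒< (ℤₚ.≤-trans (ℤₚ.≤-reflexive (ℤₚ.+-comm 1ℤ (sum f)))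
  (sum-mono-injective {1} f≤g (λ _ → j) (λ { {zero} {zero} _ → refl }) (λ _ → fj<gj)))

sum-mono-<₂ : ∀ {k} {f g : Fin k → ℤ} → (∀ i → f i ≤ g i) →
  ∀ {j l} → j ≢ l → f j < g j → f l < g l → sum f + + 2 ≤ sum g
sum-mono-<₂ {f = f} {g} f≤g {j} {l} j≢l fj<gj fl<gl =
  sum-mono-injective f≤g ι injective strict
  where
  ι : Fin 2 → _
  ι zero       = j
  ι (suc zero) = l
  injective : Injective _≡_ _≡_ ι
  injective {zero}     {zero}     _  = refl
  injective {zero}     {suc zero} eq = contradiction eq j≢l
  injective {suc zero} {zero}     eq = contradiction (sym eq) j≢l
  injective {suc zero} {suc zero} _  = refl
  strict : ∀ i → f (ι i) < g (ι i)
  strict zero       = fj<gj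
  strict (suc zero) = fl<gl

-- Applied below with `i` the one hyperedge that contains all the points in question and `c` the
-- loss that it causes.
sum-mono-except : ∀ {k} {f g : Fin k → ℤ} i c → f i ≤ g i + c →
  (∀ j → j ≢ i → f j ≤ g j) → sum f ≤ sum g + c
sum-mono-except {suc k} {f} {g} i c at-i elsewhere =
  subst₂ (λ x y → x ≤ y + c) (sym (sum-remove f)) (sym (sum-remove g))
    (combine (f i) (g i) _ _ at-i (sum-mono (λ j → elsewhere _ (punchInᵢ≢i i j))))
  where
  combine : ∀ x y s t → x ≤ y + c → s ≤ t → x + s ≤ y + t + c
  combine x y s t p q = ≤-certificate (ℤₚ.+-mono-≤ p q) (solve (c ∷ x ∷ y ∷ s ∷ t ∷ []))

-- Finite subsets

∪-lub : ∀ {m} {A B C : Subset m} → A ⊆ C → B ⊆ C → A ∪ B ⊆ C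
∪-lub {A = A} {B} A⊆C B⊆C x∈ = [ A⊆C , B⊆C ]′ (x∈p∪q⁻ A B x∈)

∪-inˡ : ∀ {m} {A B : Subset m} {x} → x ∈ A → x ∈ A ∪ B
∪-inˡ = x∈p∪q⁺ ∘ inj₁

∪-inʳ : ∀ {m} {A B : Subset m} {x} → x ∈ B → x ∈ A ∪ B
∪-inʳ = x∈p∪q⁺ ∘ inj₂

⁅⁆⊆ : ∀ {m} {x : Fin m} {A} → x ∈ A → ⁅ x ⁆ ⊆ A
⁅⁆⊆ {x = x} {A} x∈A y∈ = subst (_∈ A) (sym (x∈⁅y⁆⇒x≡y x y∈)) x∈A

pair : ∀ {m} → Fin m → Fin m → Subset m
pair a b = ⁅ a ⁆ ∪ ⁅ b ⁆

triple : ∀ {m} → Fin m → Fin m → Fin m → Subset m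
triple a b c = ⁅ a ⁆ ∪ pair b c

pair⊆ : ∀ {m} {a b : Fin m} {A} → a ∈ A → b ∈ A → pair a b ⊆ A
pair⊆ a∈A b∈A = ∪-lub (⁅⁆⊆ a∈A) (⁅⁆⊆ b∈A)

triple⊆ : ∀ {m} {a b c : Fin m} {A} → a ∈ A → b ∈ A → c ∈ A → triple a b c ⊆ A
triple⊆ a∈A b∈A c∈A = ∪-lub (⁅⁆⊆ a∈A) (pair⊆ b∈A c∈A)

∣p∪q∣+∣p∩q∣ : ∀ {m} (p q : Subset m) → ∣ p ∪ q ∣ ℕ.+ ∣ p ∩ q ∣ ≡ ∣ p ∣ ℕ.+ ∣ q ∣
∣p∪q∣+∣p∩q∣ Vec.[] Vec.[] = refl
∣p∪q∣+∣p∩q∣ (outside Vec.∷ p) (outside Vec.∷ q) = ∣p∪q∣+∣p∩q∣ p q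
∣p∪q∣+∣p∩q∣ (inside Vec.∷ p)  (outside Vec.∷ q) = cong suc (∣p∪q∣+∣p∩q∣ p q)
∣p∪q∣+∣p∩q∣ (outside Vec.∷ p) (inside Vec.∷ q)  =
  trans (cong suc (∣p∪q∣+∣p∩q∣ p q)) (sym (ℕₚ.+-suc _ _))
∣p∪q∣+∣p∩q∣ (inside Vec.∷ p)  (inside Vec.∷ q)  = cong suc
  (trans (ℕₚ.+-suc _ _) (trans (cong suc (∣p∪q∣+∣p∩q∣ p q)) (sym (ℕₚ.+-suc _ _))))

∣⁅a⁆∪p∣ : ∀ {m} {a : Fin m} {p} → a ∉ p → ∣ ⁅ a ⁆ ∪ p ∣ ≡ suc ∣ p ∣
∣⁅a⁆∪p∣ {m} {a} {p} a∉p = begin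
  ∣ ⁅ a ⁆ ∪ p ∣                        ≡⟨ ℕₚ.+-identityʳ _ ⟨
  ∣ ⁅ a ⁆ ∪ p ∣ ℕ.+ 0                  ≡⟨ cong (∣ ⁅ a ⁆ ∪ p ∣ ℕ.+_) ∣∩∣≡0 ⟨
  ∣ ⁅ a ⁆ ∪ p ∣ ℕ.+ ∣ ⁅ a ⁆ ∩ p ∣      ≡⟨ ∣p∪q∣+∣p∩q∣ ⁅ a ⁆ p ⟩
  ∣ ⁅ a ⁆ ∣ ℕ.+ ∣ p ∣                  ≡⟨ cong (ℕ._+ ∣ p ∣) (∣⁅x⁆∣≡1 a) ⟩
  suc ∣ p ∣                            ∎
  where
  open Relation.Binary.PropositionalEquality.≡-Reasoning
  empty : Empty (⁅ a ⁆ ∩ p)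
  empty (x , x∈) with x∈p∩q⁻ ⁅ a ⁆ p x∈
  ... | x∈a , x∈p = a∉p (subst (_∈ p) (x∈⁅y⁆⇒x≡y a x∈a) x∈p)
  ∣∩∣≡0 : ∣ ⁅ a ⁆ ∩ p ∣ ≡ 0
  ∣∩∣≡0 = trans (cong ∣_∣ (Empty-unique empty)) (∣⊥∣≡0 m)

∣pair∣≡2 : ∀ {m} {a b : Fin m} → a ≢ b → ∣ pair a b ∣ ≡ 2
∣pair∣≡2 {b = b} a≢b = trans (∣⁅a⁆∪p∣ (x≢y⇒x∉⁅y⁆ a≢b)) (cong suc (∣⁅x⁆∣≡1 b))

∣triple∣≡3 : ∀ {m} {a b c : Fin m} → a ≢ b → a ≢ c → b ≢ c → ∣ triple a b c ∣ ≡ 3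
∣triple∣≡3 {a = a} {b} {c} a≢b a≢c b≢c =
  trans (∣⁅a⁆∪p∣ a∉) (cong suc (∣pair∣≡2 b≢c))
  where
  a∉ : a ∉ pair b c
  a∉ a∈ = [ a≢b ∘ x∈⁅y⁆⇒x≡y b , a≢c ∘ x∈⁅y⁆⇒x≡y c ]′ (x∈p∪q⁻ ⁅ b ⁆ ⁅ c ⁆ a∈)

∈-subsets : ∀ {m} (A : Subset m) → A ListMem.∈ subsets m
∈-subsets Vec.[] = here refl
∈-subsets (outside Vec.∷ A) = ∈-++⁺ˡ (∈-map⁺ (outside Vec.∷_) (∈-subsets A))
∈-subsets (inside Vec.∷ A)  =
  ∈-++⁺ʳ (List.map (outside Vec.∷_) (subsets _)) (∈-map⁺ (inside Vec.∷_) (∈-subsets A))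

-- Polymatroids

module _ {m} {r : Subset m → ℤ} (P : IsPolymatroid r) where

  0≤rank : ∀ A → 0ℤ ≤ r A
  0≤rank A = subst (_≤ r A) (normalized P) (monotone P ⊥ A (λ x∈ → contradiction x∈ ∉⊥))

  -- Passing to subsets of the union and the intersection spares computing these exactly for pairs
  -- and triples.
  submodular-⊆ : ∀ {A B C D} → C ⊆ A ∪ B → D ⊆ A → D ⊆ B → r C + r D ≤ r A + r B
  submodular-⊆ {A} {B} {C} {D} C⊆ D⊆A D⊆B = ℤₚ.≤-trans
    (ℤₚ.+-mono-≤ (monotone P C (A ∪ B) C⊆)
                 (monotone P D (A ∩ B) (λ x∈ → x∈p∩q⁺ (D⊆A x∈ , D⊆B x∈))))
    (submodular P A B)

  subadditive : ∀ {A B C} → C ⊆ A ∪ B → r C ≤ r A + r B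
  subadditive {A} {B} {C} C⊆ = begin
    r C        ≡⟨ ℤₚ.+-identityʳ (r C) ⟨
    r C + 0ℤ   ≡⟨ cong (_+_ (r C)) (normalized P) ⟨
    r C + r ⊥  ≤⟨ submodular-⊆ C⊆ (λ x∈ → contradiction x∈ ∉⊥) (λ x∈ → contradiction x∈ ∉⊥) ⟩
    r A + r B  ∎
    where open ≤-Reasoning

  -- If both values are at most `s`, drop the caps on the left and use submodularity of `r`.
  -- Otherwise one of the sets has truncated value `s`, which bounds the term of the union, and the
  -- other set bounds the term of the intersection by monotonicity.
  truncate-isPolymatroid : ∀ {s} → 0ℤ ≤ s → IsPolymatroid (truncate r s)
  truncate-isPolymatroid {s} 0≤s .normalized =
    trans (cong (_⊓ s) (normalized P)) (ℤₚ.i≤j⇒i⊓j≡i 0≤s)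
  truncate-isPolymatroid {s} 0≤s .monotone A B A⊆B = ℤₚ.⊓-monoˡ-≤ s (monotone P A B A⊆B)
  truncate-isPolymatroid {s} 0≤s .submodular A B with ℤₚ.≤-total (r A) s | ℤₚ.≤-total (r B) s
  ... | inj₁ rA≤s | inj₁ rB≤s = begin
    r (A ∪ B) ⊓ s + r (A ∩ B) ⊓ s ≤⟨ ℤₚ.+-mono-≤ (ℤₚ.i⊓j≤i (r (A ∪ B)) s) (ℤₚ.i⊓j≤i (r (A ∩ B)) s) ⟩
    r (A ∪ B) + r (A ∩ B)         ≤⟨ submodular P A B ⟩
    r A + r B                     ≡⟨ cong₂ _+_ (ℤₚ.i≤j⇒i⊓j≡i rA≤s) (ℤₚ.i≤j⇒i⊓j≡i rB≤s) ⟨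
    r A ⊓ s + r B ⊓ s             ∎
    where open ≤-Reasoning
  ... | inj₂ s≤rA | _ = begin
    r (A ∪ B) ⊓ s + r (A ∩ B) ⊓ s ≤⟨ ℤₚ.+-mono-≤ (ℤₚ.i⊓j≤j (r (A ∪ B)) s)
                                       (ℤₚ.⊓-monoˡ-≤ s (monotone P _ _ (p∩q⊆q A B))) ⟩
    s + r B ⊓ s                   ≡⟨ cong (_+ r B ⊓ s) (ℤₚ.i≥j⇒i⊓j≡j s≤rA) ⟨
    r A ⊓ s + r B ⊓ s             ∎
    where open ≤-Reasoning
  ... | inj₁ _ | inj₂ s≤rB = begin
    r (A ∪ B) ⊓ s + r (A ∩ B) ⊓ s ≡⟨ ℤₚ.+-comm (r (A ∪ B) ⊓ s) _ ⟩
    r (A ∩ B) ⊓ s + r (A ∪ B) ⊓ s ≤⟨ ℤₚ.+-mono-≤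
                                       (ℤₚ.⊓-monoˡ-≤ s (monotone P _ _ (p∩q⊆p A B)))
                                       (ℤₚ.i⊓j≤j (r (A ∪ B)) s) ⟩
    r A ⊓ s + s                   ≡⟨ cong (_+_ (r A ⊓ s)) (ℤₚ.i≥j⇒i⊓j≡j s≤rB) ⟨
    r A ⊓ s + r B ⊓ s             ∎
    where open ≤-Reasoning

-- Truncated at one, this function becomes `hit`. So `ρ` is a polymatroid because sums and
-- truncations at nonnegative values preserve the axioms.
∣-∩X∣-isPolymatroid : ∀ {m} (X : Subset m) → IsPolymatroid (λ A → + ∣ A ∩ X ∣)
∣-∩X∣-isPolymatroid {m} X .normalized =
  cong +_ (trans (cong ∣_∣ (∩-zeroˡ X)) (∣⊥∣≡0 m))
∣-∩X∣-isPolymatroid X .monotone A B A⊆B = +≤+ (p⊆q⇒∣p∣≤∣q∣ A∩X⊆B∩X)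
  where
  A∩X⊆B∩X : A ∩ X ⊆ B ∩ X
  A∩X⊆B∩X x∈ = x∈p∩q⁺ (A⊆B (p∩q⊆p A X x∈) , p∩q⊆q A X x∈)
∣-∩X∣-isPolymatroid X .submodular A B = +≤+ (begin
  ∣ (A ∪ B) ∩ X ∣ ℕ.+ ∣ (A ∩ B) ∩ X ∣
    ≤⟨ ℕₚ.+-mono-≤ (ℕₚ.≤-reflexive (cong ∣_∣ (∩-distribʳ-∪ X A B))) (p⊆q⇒∣p∣≤∣q∣ meet) ⟩
  ∣ (A ∩ X) ∪ (B ∩ X) ∣ ℕ.+ ∣ (A ∩ X) ∩ (B ∩ X) ∣
    ≡⟨ ∣p∪q∣+∣p∩q∣ (A ∩ X) (B ∩ X) ⟩
  ∣ A ∩ X ∣ ℕ.+ ∣ B ∩ X ∣ ∎)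
  where
  open ℕₚ.≤-Reasoning
  meet : (A ∩ B) ∩ X ⊆ (A ∩ X) ∩ (B ∩ X)
  meet x∈ with x∈p∩q⁻ (A ∩ B) X x∈
  ... | x∈AB , x∈X =
    x∈p∩q⁺ (x∈p∩q⁺ (p∩q⊆p A B x∈AB , x∈X) , x∈p∩q⁺ (p∩q⊆q A B x∈AB , x∈X))

sum-isPolymatroid : ∀ {m k} {r : Fin k → Subset m → ℤ} → (∀ i → IsPolymatroid (r i)) →
  IsPolymatroid (λ A → sum (λ i → r i A))
sum-isPolymatroid {k = k} P .normalized =
  trans (sum-cong-≗ (λ i → normalized (P i))) (sum-replicate-zero k)
sum-isPolymatroid P .monotone A B A⊆B = sum-mono (λ i → monotone (P i) A B A⊆B)
sum-isPolymatroid {r = r} P .submodular A B = subst₂ _≤_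
  (∑-distrib-+ (λ i → r i (A ∪ B)) (λ i → r i (A ∩ B)))
  (∑-distrib-+ (λ i → r i A) (λ i → r i B))
  (sum-mono (λ i → submodular (P i) A B))

-- Parallel elements

-- For a matroid rank this says that a and b are non-loops and parallel or
-- equal, so Parallel r a a means that a is not a loop.
Parallel : ∀ {m} → (Subset m → ℤ) → Fin m → Fin m → Set
Parallel r a b = r (pair a b) < r ⁅ a ⁆ + r ⁅ b ⁆

Parallel-sym : ∀ {m} {r : Subset m → ℤ} {a b} → Parallel r a b → Parallel r b a
Parallel-sym {r = r} {a} {b} =
  subst₂ _<_ (cong r (∪-comm ⁅ a ⁆ ⁅ b ⁆)) (ℤₚ.+-comm (r ⁅ a ⁆) (r ⁅ b ⁆))

-- Since `r ⁅ a ⁆ ≤ r (pair a a)`, the hypothesis gives `r ⁅ a ⁆ < r ⁅ a ⁆ + r ⁅ a ⁆`, so `a` has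
-- positive rank. This is the unit that a summand contributes to the final count.
nonloop : ∀ {m} {r : Subset m → ℤ} → IsPolymatroid r → ∀ {a} → Parallel r a a → r ⊥ < r ⊤
nonloop {r = r} P {a} a∥a = ℤₚ.<-≤-trans
  (subst (_< r ⁅ a ⁆) (sym (normalized P))
    (arith (r ⁅ a ⁆) (r (pair a a)) (monotone P ⁅ a ⁆ (pair a a) ∪-inˡ) (<⇒1+≤ a∥a)))
  (monotone P ⁅ a ⁆ ⊤ (λ _ → ∈⊤))
  where
  arith : ∀ x xx → x ≤ xx → 1ℤ + xx ≤ x + x → 0ℤ < x
  arith x xx p q = 1+≤⇒< (≤-certificate (ℤₚ.+-mono-≤ p q) (solve (x ∷ xx ∷ [])))

module _ {m} (M : Matroid m) where
  open Matroid M

  singleton≤1 : ∀ a → rank ⁅ a ⁆ ≤ 1ℤ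
  singleton≤1 a = subst (λ x → rank ⁅ a ⁆ ≤ + x) (∣⁅x⁆∣≡1 a) (rank≤size ⁅ a ⁆)

  -- Submodularity on the two pairs, which share `b`, bounds `rank (pair a c) + rank ⁅ b ⁆`. The two
  -- defects total at least 2, and `rank ⁅ b ⁆ ≤ 1` absorbs only one of them. Here alone the matroid
  -- bound on singletons enters.
  Parallel-trans : ∀ {a b c} → Parallel rank a b → Parallel rank b c → Parallel rank a c
  Parallel-trans {a} {b} {c} a∥b b∥c = 1+≤⇒< (arith (rank ⁅ a ⁆) (rank ⁅ b ⁆) (rank ⁅ c ⁆)
      (rank (pair a b)) (rank (pair b c)) (rank (pair a c))
    (<⇒1+≤ a∥b) (<⇒1+≤ b∥c) (singleton≤1 b)
    (submodular-⊆ isPolymatroid {A = pair a b} {pair b c} {D = ⁅ b ⁆}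
      (pair⊆ (∪-inˡ (∪-inˡ (x∈⁅x⁆ a))) (∪-inʳ (∪-inʳ (x∈⁅x⁆ c)))) ∪-inʳ ∪-inˡ))
    where
    arith : ∀ x y z ab bc ac → 1ℤ + ab ≤ x + y → 1ℤ + bc ≤ y + z → y ≤ 1ℤ →
      ac + y ≤ ab + bc → 1ℤ + ac ≤ x + z
    arith x y z ab bc ac p q u v =
      ≤-certificate (ℤₚ.+-mono-≤ (ℤₚ.+-mono-≤ p q) (ℤₚ.+-mono-≤ u v))
        (solve (x ∷ y ∷ z ∷ ab ∷ bc ∷ ac ∷ []))

  -- At most one of the three pairs can fail to be parallel, and transitivity
  -- then repairs that one.
  Parallel-triple : ∀ {a b c} →
    rank (pair a b) + rank (pair b c) + rank (pair a c) <
      rank ⁅ a ⁆ + rank ⁅ b ⁆ + rank ⁅ c ⁆ + rank (triple a b c) →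
    Parallel rank a b × Parallel rank a c
  Parallel-triple {a} {b} {c} surplus
    with rank (pair a b) ℤₚ.<? rank ⁅ a ⁆ + rank ⁅ b ⁆
       | rank (pair b c) ℤₚ.<? rank ⁅ b ⁆ + rank ⁅ c ⁆
       | rank (pair a c) ℤₚ.<? rank ⁅ a ⁆ + rank ⁅ c ⁆
  ... | yes ab | _      | yes ac = ab , ac
  ... | yes ab | yes bc | no  _  = ab , Parallel-trans ab bc
  ... | no  _  | yes bc | yes ac = Parallel-trans ac (Parallel-sym {r = rank} bc) , ac
  -- Two failing pairs share a point, here `b`. They have no defect, and the rank of the triple is
  -- at most that of the third pair plus that of the shared point; together this contradicts
  -- `surplus`. In the next two cases the shared point is `c`, then `a`.
  ... | no ¬ab | no ¬bc | _      = contradiction surplus (ℤₚ.≤⇒≯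
    (arith (rank ⁅ a ⁆) (rank ⁅ b ⁆) (rank ⁅ c ⁆)
      (rank (pair a b)) (rank (pair b c)) (rank (pair a c)) (rank (triple a b c))
      (ℤₚ.≮⇒≥ ¬ab) (ℤₚ.≮⇒≥ ¬bc)
      (subadditive isPolymatroid (triple⊆ {A = pair a c ∪ ⁅ b ⁆}
        (∪-inˡ (∪-inˡ (x∈⁅x⁆ a))) (∪-inʳ (x∈⁅x⁆ b)) (∪-inˡ (∪-inʳ (x∈⁅x⁆ c)))))))
    where
    arith : ∀ x y z ab bc ac abc → x + y ≤ ab → y + z ≤ bc → abc ≤ ac + y →
      x + y + z + abc ≤ ab + bc + ac
    arith x y z ab bc ac abc p q u = ≤-certificate (ℤₚ.+-mono-≤ (ℤₚ.+-mono-≤ p q) u)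
      (solve (x ∷ y ∷ z ∷ ab ∷ bc ∷ ac ∷ abc ∷ []))
  ... | yes _  | no ¬bc | no ¬ac = contradiction surplus (ℤₚ.≤⇒≯
    (arith (rank ⁅ a ⁆) (rank ⁅ b ⁆) (rank ⁅ c ⁆)
      (rank (pair a b)) (rank (pair b c)) (rank (pair a c)) (rank (triple a b c))
      (ℤₚ.≮⇒≥ ¬bc) (ℤₚ.≮⇒≥ ¬ac)
      (subadditive isPolymatroid (triple⊆ {A = pair a b ∪ ⁅ c ⁆}
        (∪-inˡ (∪-inˡ (x∈⁅x⁆ a))) (∪-inˡ (∪-inʳ (x∈⁅x⁆ b))) (∪-inʳ (x∈⁅x⁆ c))))))
    where
    arith : ∀ x y z ab bc ac abc → y + z ≤ bc → x + z ≤ ac → abc ≤ ab + z →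
      x + y + z + abc ≤ ab + bc + ac
    arith x y z ab bc ac abc p q u = ≤-certificate (ℤₚ.+-mono-≤ (ℤₚ.+-mono-≤ p q) u)
      (solve (x ∷ y ∷ z ∷ ab ∷ bc ∷ ac ∷ abc ∷ []))
  ... | no ¬ab | yes _  | no ¬ac = contradiction surplus (ℤₚ.≤⇒≯
    (arith (rank ⁅ a ⁆) (rank ⁅ b ⁆) (rank ⁅ c ⁆)
      (rank (pair a b)) (rank (pair b c)) (rank (pair a c)) (rank (triple a b c))
      (ℤₚ.≮⇒≥ ¬ab) (ℤₚ.≮⇒≥ ¬ac)
      (subadditive isPolymatroid (triple⊆ {A = pair b c ∪ ⁅ a ⁆}
        (∪-inʳ (x∈⁅x⁆ a)) (∪-inˡ (∪-inˡ (x∈⁅x⁆ b))) (∪-inˡ (∪-inʳ (x∈⁅x⁆ c)))))))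
    where
    arith : ∀ x y z ab bc ac abc → x + y ≤ ab → x + z ≤ ac → abc ≤ bc + x →
      x + y + z + abc ≤ ab + bc + ac
    arith x y z ab bc ac abc p q u = ≤-certificate (ℤₚ.+-mono-≤ (ℤₚ.+-mono-≤ p q) u)
      (solve (x ∷ y ∷ z ∷ ab ∷ bc ∷ ac ∷ abc ∷ []))

-- Hypergraph ranks

module _ {m n} (H : Hypergraph m n) where
  open Hypergraph H renaming (edge to X)

  -- The rank function of the matroid whose non-loops are the elements of `X i`, all parallel to one
  -- another.
  hit : Fin n → Subset m → ℤ
  hit i A = + (∣ A ∩ X i ∣ ℕ.⊓ 1)

  private
    ρ = hypergraphRank H

  hit-isPolymatroid : ∀ i → IsPolymatroid (hit i)
  hit-isPolymatroid i = truncate-isPolymatroid (∣-∩X∣-isPolymatroid (X i)) {1ℤ} (+≤+ z≤n)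

  hypergraphRank-isPolymatroid : IsPolymatroid ρ
  hypergraphRank-isPolymatroid = sum-isPolymatroid hit-isPolymatroid

  hit-∈ : ∀ {i x A} → x ∈ A → x ∈ X i → hit i A ≡ 1ℤ
  hit-∈ {i} {x} {A} x∈A x∈X = cong +_ (ℕₚ.m≥n⇒m⊓n≡n
    (subst (ℕ._≤ ∣ A ∩ X i ∣) (∣⁅x⁆∣≡1 x) (p⊆q⇒∣p∣≤∣q∣ (⁅⁆⊆ (x∈p∩q⁺ (x∈A , x∈X))))))

  hit-∉ : ∀ {i a} → a ∉ X i → hit i ⁅ a ⁆ ≡ 0ℤ
  hit-∉ {i} {a} a∉X =
    cong (λ c → + (c ℕ.⊓ 1)) (trans (cong ∣_∣ (Empty-unique empty)) (∣⊥∣≡0 m))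
    where
    empty : Empty (⁅ a ⁆ ∩ X i)
    empty (x , x∈) with x∈p∩q⁻ ⁅ a ⁆ (X i) x∈
    ... | x∈a , x∈X = a∉X (subst (_∈ X i) (x∈⁅y⁆⇒x≡y a x∈a) x∈X)

  -- At most one term on the left is nonzero, and monotonicity bounds that one.
  hit-pair : ∀ {i a b} → ¬ (a ∈ X i × b ∈ X i) →
    hit i ⁅ a ⁆ + hit i ⁅ b ⁆ ≤ hit i (pair a b)
  hit-pair {i} {a} {b} ¬both with a ∈? X i
  ... | yes a∈X = begin
    hit i ⁅ a ⁆ + hit i ⁅ b ⁆  ≡⟨ cong (_+_ (hit i ⁅ a ⁆)) (hit-∉ (¬both ∘ (a∈X ,_))) ⟩
    hit i ⁅ a ⁆ + 0ℤ           ≡⟨ ℤₚ.+-identityʳ (hit i ⁅ a ⁆) ⟩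
    hit i ⁅ a ⁆                ≤⟨ monotone (hit-isPolymatroid i) ⁅ a ⁆ (pair a b) ∪-inˡ ⟩
    hit i (pair a b)           ∎
    where open ≤-Reasoning
  ... | no a∉X = begin
    hit i ⁅ a ⁆ + hit i ⁅ b ⁆  ≡⟨ cong (_+ hit i ⁅ b ⁆) (hit-∉ a∉X) ⟩
    0ℤ + hit i ⁅ b ⁆           ≡⟨ ℤₚ.+-identityˡ (hit i ⁅ b ⁆) ⟩
    hit i ⁅ b ⁆                ≤⟨ monotone (hit-isPolymatroid i) ⁅ b ⁆ (pair a b) ∪-inʳ ⟩
    hit i (pair a b)           ∎
    where open ≤-Reasoning

  hit-triple : ∀ {i a b c} →
    ¬ (a ∈ X i × b ∈ X i) → ¬ (a ∈ X i × c ∈ X i) → ¬ (b ∈ X i × c ∈ X i) →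
    hit i ⁅ a ⁆ + hit i ⁅ b ⁆ + hit i ⁅ c ⁆ ≤ hit i (triple a b c)
  hit-triple {i} {a} {b} {c} ¬ab ¬ac ¬bc with a ∈? X i
  ... | yes a∈X = begin
    hit i ⁅ a ⁆ + hit i ⁅ b ⁆ + hit i ⁅ c ⁆
      ≡⟨ cong₂ (λ x y → hit i ⁅ a ⁆ + x + y) (hit-∉ (¬ab ∘ (a∈X ,_))) (hit-∉ (¬ac ∘ (a∈X ,_))) ⟩
    hit i ⁅ a ⁆ + 0ℤ + 0ℤ
      ≡⟨ trans (ℤₚ.+-identityʳ (hit i ⁅ a ⁆ + 0ℤ)) (ℤₚ.+-identityʳ (hit i ⁅ a ⁆)) ⟩
    hit i ⁅ a ⁆
      ≤⟨ monotone (hit-isPolymatroid i) ⁅ a ⁆ (triple a b c) ∪-inˡ ⟩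
    hit i (triple a b c) ∎
    where open ≤-Reasoning
  ... | no a∉X = begin
    hit i ⁅ a ⁆ + hit i ⁅ b ⁆ + hit i ⁅ c ⁆
      ≡⟨ cong (λ x → x + hit i ⁅ b ⁆ + hit i ⁅ c ⁆) (hit-∉ a∉X) ⟩
    0ℤ + hit i ⁅ b ⁆ + hit i ⁅ c ⁆
      ≡⟨ cong (_+ hit i ⁅ c ⁆) (ℤₚ.+-identityˡ (hit i ⁅ b ⁆)) ⟩
    hit i ⁅ b ⁆ + hit i ⁅ c ⁆
      ≤⟨ hit-pair {i} {b} {c} ¬bc ⟩
    hit i (pair b c)
      ≤⟨ monotone (hit-isPolymatroid i) (pair b c) (triple a b c) ∪-inʳ ⟩
    hit i (triple a b c) ∎
    where open ≤-Reasoning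

  -- The hyperedge `X i` counts once for the pair but twice for the two singletons, and by
  -- subadditivity no other hyperedge can compensate.
  hypergraphRank-edge : ∀ {i a b} → a ∈ X i → b ∈ X i → Parallel ρ a b
  hypergraphRank-edge {i} {a} {b} a∈X b∈X = subst (ρ (pair a b) <_)
    (∑-distrib-+ (λ j → hit j ⁅ a ⁆) (λ j → hit j ⁅ b ⁆))
    (sum-mono-< (λ j → subadditive (hit-isPolymatroid j) {⁅ a ⁆} {⁅ b ⁆} (λ x∈ → x∈)) i
      (subst₂ _<_ (sym (hit-∈ {A = pair a b} (∪-inˡ (x∈⁅x⁆ a)) a∈X))
        (sym (cong₂ _+_ (hit-∈ (x∈⁅x⁆ a) a∈X) (hit-∈ (x∈⁅x⁆ b) b∈X)))
        (1+≤⇒< {1ℤ} ℤₚ.≤-refl)))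

  hypergraphRank-separated : ∀ {a b} → ¬ (∃[ i ] pair a b ⊆ X i) →
    ρ ⁅ a ⁆ + ρ ⁅ b ⁆ ≤ ρ (pair a b)
  hypergraphRank-separated {a} {b} separated = subst (_≤ ρ (pair a b))
    (∑-distrib-+ (λ j → hit j ⁅ a ⁆) (λ j → hit j ⁅ b ⁆))
    (sum-mono (λ j → hit-pair {j} {a} {b} (λ (a∈X , b∈X) → separated (j , pair⊆ a∈X b∈X))))

  Small-singleton : ∀ a → Small H ⁅ a ⁆
  Small-singleton a = inj₁ (subst (ℕ._≤ 2) (sym (∣⁅x⁆∣≡1 a)) (s≤s z≤n))

  Small-pair : ∀ {a b} → a ≢ b → Small H (pair a b)
  Small-pair a≢b = inj₁ (ℕₚ.≤-reflexive (∣pair∣≡2 a≢b))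

  Small⇒≤maxSmallRank : ∀ {A} → Small H A → ρ A ≤ maxSmallRank H
  Small⇒≤maxSmallRank {A} small = All.lookup (xs≤max (ρ ⊥) _)
    (∈-map⁺ ρ (∈-filter⁺ (small? H) (∈-subsets A) small))

  -- Supplies the condition `0 ≤ s` under which the truncation stays normalized.
  0≤maxSmallRank : 0ℤ ≤ maxSmallRank H
  0≤maxSmallRank =
    ℤₚ.≤-trans (0≤rank hypergraphRank-isPolymatroid ⊥)
      (⊥≤max (ρ ⊥) (List.map ρ (List.filter (small? H) (subsets m))))

  -- Pairs and triples inside a hyperedge of a linear hypergraph

  module _ (linear : ∀ i j → i ≢ j → ∣ X i ∩ X j ∣ ℕ.≤ 1) where

    edge-unique : ∀ {a b i j} → a ≢ b → a ∈ X i → b ∈ X i → j ≢ i → ¬ (a ∈ X j × b ∈ X j)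
    edge-unique {i = i} {j} a≢b a∈Xᵢ b∈Xᵢ j≢i (a∈Xⱼ , b∈Xⱼ) = ℕₚ.<⇒≱
      (subst (ℕ._≤ ∣ X j ∩ X i ∣) (∣pair∣≡2 a≢b)
        (p⊆q⇒∣p∣≤∣q∣ (pair⊆ (x∈p∩q⁺ (a∈Xⱼ , a∈Xᵢ)) (x∈p∩q⁺ (b∈Xⱼ , b∈Xᵢ)))))
      (linear j i j≢i)

    -- Only `X i` contains both points, and it loses 1 + 1 - 1; the other hyperedges lose nothing by
    -- `hit-pair`.
    hypergraphRank-pair : ∀ {i a b} → a ≢ b → a ∈ X i → b ∈ X i →
      ρ ⁅ a ⁆ + ρ ⁅ b ⁆ ≤ ρ (pair a b) + 1ℤ
    hypergraphRank-pair {i} {a} {b} a≢b a∈X b∈X = subst (_≤ ρ (pair a b) + 1ℤ)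
      (∑-distrib-+ (λ j → hit j ⁅ a ⁆) (λ j → hit j ⁅ b ⁆))
      (sum-mono-except i 1ℤ
        (ℤₚ.≤-reflexive (trans (cong₂ _+_ (hit-∈ (x∈⁅x⁆ a) a∈X) (hit-∈ (x∈⁅x⁆ b) b∈X))
          (cong (_+ 1ℤ) (sym (hit-∈ {A = pair a b} (∪-inˡ (x∈⁅x⁆ a)) a∈X)))))
        (λ j j≢i → hit-pair {j} {a} {b} (edge-unique a≢b a∈X b∈X j≢i)))

    -- The constant 2 is the loss 1 + 1 + 1 - 1 at `X i`. Every other hyperedge contains at most one
    -- of the three points.
    hypergraphRank-triple : ∀ {i a b c} → a ≢ b → a ≢ c → b ≢ c →
      a ∈ X i → b ∈ X i → c ∈ X i →
      ρ ⁅ a ⁆ + ρ ⁅ b ⁆ + ρ ⁅ c ⁆ ≤ ρ (triple a b c) + + 2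
    hypergraphRank-triple {i} {a} {b} {c} a≢b a≢c b≢c a∈X b∈X c∈X =
      subst (_≤ ρ (triple a b c) + + 2)
        (trans (∑-distrib-+ (λ j → hit j ⁅ a ⁆ + hit j ⁅ b ⁆) (λ j → hit j ⁅ c ⁆))
          (cong (_+ ρ ⁅ c ⁆) (∑-distrib-+ (λ j → hit j ⁅ a ⁆) (λ j → hit j ⁅ b ⁆))))
        (sum-mono-except i (+ 2)
          (ℤₚ.≤-reflexive (trans
            (cong₂ _+_ (cong₂ _+_ (hit-∈ (x∈⁅x⁆ a) a∈X) (hit-∈ (x∈⁅x⁆ b) b∈X))
              (hit-∈ (x∈⁅x⁆ c) c∈X))
            (cong (_+ + 2) (sym (hit-∈ {A = triple a b c} (∪-inˡ (x∈⁅x⁆ a)) a∈X)))))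
          (λ j j≢i → hit-triple {j} {a} {b} {c} (edge-unique a≢b a∈X b∈X j≢i)
            (edge-unique a≢c a∈X c∈X j≢i) (edge-unique b≢c b∈X c∈X j≢i)))

    -- The summands of a decomposition

    module _
      (separation : ∀ p q → p ≢ q →
        ∃[ a ] ∃[ b ] (a ∈ X p × b ∈ X q × ¬ (∃[ i ] pair a b ⊆ X i)))
      (complete : LineGraphComplete H) where

      -- Provides the base pair from which the summand belonging to `X p` is found: the separated
      -- point of `X p` and a point that `X p` shares with `X q`.
      edge-pair : ∀ {p q} → p ≢ q → ∃[ a ] ∃[ b ] (a ≢ b × a ∈ X p × b ∈ X p)
      edge-pair {p} {q} p≢q with separation p q p≢q | proj₂ (complete p q p≢q)
      ... | a , b , a∈Xₚ , b∈X , separated | c , c∈ = a , c , a≢c , a∈Xₚ , p∩q⊆p (X p) (X q) c∈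
        where
        a≢c : a ≢ c
        -- If the two points coincided, `X q` would contain both separated points.
        a≢c refl = separated (q , pair⊆ (p∩q⊆q (X p) (X q) c∈) b∈X)

      module _ {σ : Subset m → ℤ} (P : IsPolymatroid σ)
        (agree : ∀ A → Small H A → σ A ≡ ρ A)
        {k} (M : Fin k → Matroid m)
        (σ≡Σ : ∀ A → σ A ≡ sum (λ l → Matroid.rank (M l) A)) where

        private
          r : Fin k → Subset m → ℤ
          r l = Matroid.rank (M l)

          r-isPolymatroid : ∀ l → IsPolymatroid (r l)
          r-isPolymatroid l = Matroid.isPolymatroid (M l)

          σ₁ : ∀ a → σ ⁅ a ⁆ ≡ ρ ⁅ a ⁆
          σ₁ a = agree ⁅ a ⁆ (Small-singleton a)

          σ₂ : ∀ {a b} → a ≢ b → σ (pair a b) ≡ ρ (pair a b)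
          σ₂ a≢b = agree _ (Small-pair a≢b)

        σ-edge : ∀ {i a b} → a ≢ b → a ∈ X i → b ∈ X i → Parallel σ a b
        σ-edge {a = a} {b} a≢b a∈X b∈X =
          subst₂ _<_ (sym (σ₂ a≢b)) (sym (cong₂ _+_ (σ₁ a) (σ₁ b)))
            (hypergraphRank-edge a∈X b∈X)

        Σ-pair : ∀ a b → sum (λ l → r l ⁅ a ⁆ + r l ⁅ b ⁆) ≡ σ ⁅ a ⁆ + σ ⁅ b ⁆
        Σ-pair a b = trans (∑-distrib-+ (λ l → r l ⁅ a ⁆) (λ l → r l ⁅ b ⁆))
          (sym (cong₂ _+_ (σ≡Σ ⁅ a ⁆) (σ≡Σ ⁅ b ⁆)))

        summand-subadditive : ∀ a b l → r l (pair a b) ≤ r l ⁅ a ⁆ + r l ⁅ b ⁆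
        summand-subadditive a b l = subadditive (r-isPolymatroid l) {⁅ a ⁆} {⁅ b ⁆} (λ x∈ → x∈)

        Parallel-summand : ∀ {a b} → Parallel σ a b → ∃[ l ] Parallel (r l) a b
        Parallel-summand {a} {b} a∥b =
          sum-<⇒∃< _ _ (subst₂ _<_ (σ≡Σ (pair a b)) (sym (Σ-pair a b)) a∥b)

        -- All summands are subadditive, so a defect in one of them cannot be cancelled by the
        -- others.
        Parallel-summand⁻ : ∀ {a b} l → Parallel (r l) a b → Parallel σ a b
        Parallel-summand⁻ {a} {b} l a∥b = subst₂ _<_ (sym (σ≡Σ (pair a b))) (Σ-pair a b)
          (sum-mono-< (summand-subadditive a b) l a∥b)

        -- Two different summands would each contribute a unit of defect, while
        -- `hypergraphRank-pair` allows one in total.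
        Parallel-summand-unique : ∀ {i a b} → a ≢ b → a ∈ X i → b ∈ X i →
          ∀ {l l′} → Parallel (r l) a b → Parallel (r l′) a b → l ≡ l′
        Parallel-summand-unique {i} {a} {b} a≢b a∈X b∈X {l} {l′} ∥l ∥l′ with l Finₚ.≟ l′
        ... | yes l≡l′ = l≡l′
        ... | no  l≢l′ = contradiction (begin
          σ (pair a b) + + 2   ≡⟨ cong (_+ + 2) (σ≡Σ (pair a b)) ⟩
          sum (λ l → r l (pair a b)) + + 2
                               ≤⟨ sum-mono-<₂ (summand-subadditive a b) l≢l′ ∥l ∥l′ ⟩
          sum (λ l → r l ⁅ a ⁆ + r l ⁅ b ⁆)
                               ≡⟨ Σ-pair a b ⟩
          σ ⁅ a ⁆ + σ ⁅ b ⁆    ≡⟨ cong₂ _+_ (σ₁ a) (σ₁ b) ⟩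
          ρ ⁅ a ⁆ + ρ ⁅ b ⁆    ≤⟨ hypergraphRank-pair a≢b a∈X b∈X ⟩
          ρ (pair a b) + 1ℤ    ≡⟨ cong (_+ 1ℤ) (σ₂ a≢b) ⟨
          σ (pair a b) + 1ℤ    ∎)
          (ℤₚ.<⇒≱ (ℤₚ.+-monoʳ-< (σ (pair a b)) (1+≤⇒< {1ℤ} ℤₚ.≤-refl)))
          where open ≤-Reasoning

        -- The three pairs have total defect at least 3 and the triple has defect at most 2. This
        -- makes the inequality `σ-surplus` strict, so it is strict in some summand, and there
        -- `Parallel-triple` applies.
        triple-summand : ∀ {i a b c} → a ≢ b → a ≢ c → b ≢ c →
          a ∈ X i → b ∈ X i → c ∈ X i →
          ∃[ l ] (Parallel (r l) a b × Parallel (r l) a c)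
        triple-summand {i} {a} {b} {c} a≢b a≢c b≢c a∈X b∈X c∈X =
          Product.map₂ (λ {l} → Parallel-triple (M l) {a} {b} {c}) (sum-<⇒∃<
            (λ l → r l (pair a b) + r l (pair b c) + r l (pair a c))
            (λ l → r l ⁅ a ⁆ + r l ⁅ b ⁆ + r l ⁅ c ⁆ + r l (triple a b c)) surplus)
          where
          σ-triple : σ ⁅ a ⁆ + σ ⁅ b ⁆ + σ ⁅ c ⁆ ≤ σ (triple a b c) + + 2
          σ-triple = subst₂ _≤_
            (sym (cong₂ _+_ (cong₂ _+_ (σ₁ a) (σ₁ b)) (σ₁ c)))
            (cong (_+ + 2) (sym (agree (triple a b c)
              (inj₂ (∣triple∣≡3 a≢b a≢c b≢c , i , triple⊆ a∈X b∈X c∈X)))))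
            (hypergraphRank-triple a≢b a≢c b≢c a∈X b∈X c∈X)
          arith : ∀ x y z xy yz xz xyz → 1ℤ + xy ≤ x + y → 1ℤ + yz ≤ y + z →
            1ℤ + xz ≤ x + z → x + y + z ≤ xyz + + 2 →
            1ℤ + (xy + yz + xz) ≤ x + y + z + xyz
          arith x y z xy yz xz xyz p q u v =
            ≤-certificate (ℤₚ.+-mono-≤ (ℤₚ.+-mono-≤ p q) (ℤₚ.+-mono-≤ u v))
              (solve (x ∷ y ∷ z ∷ xy ∷ yz ∷ xz ∷ xyz ∷ []))
          σ-surplus : σ (pair a b) + σ (pair b c) + σ (pair a c) <
            σ ⁅ a ⁆ + σ ⁅ b ⁆ + σ ⁅ c ⁆ + σ (triple a b c)
          σ-surplus = 1+≤⇒< (arith (σ ⁅ a ⁆) (σ ⁅ b ⁆) (σ ⁅ c ⁆)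
            (σ (pair a b)) (σ (pair b c)) (σ (pair a c)) (σ (triple a b c))
            (<⇒1+≤ (σ-edge a≢b a∈X b∈X)) (<⇒1+≤ (σ-edge b≢c b∈X c∈X))
            (<⇒1+≤ (σ-edge a≢c a∈X c∈X)) σ-triple)
          surplus : sum (λ l → r l (pair a b) + r l (pair b c) + r l (pair a c)) <
            sum (λ l → r l ⁅ a ⁆ + r l ⁅ b ⁆ + r l ⁅ c ⁆ + r l (triple a b c))
          surplus = subst₂ _<_
            (sym (trans (∑-distrib-+ (λ l → r l (pair a b) + r l (pair b c)) _)
              (trans (cong (_+ sum (λ l → r l (pair a c)))
                (∑-distrib-+ (λ l → r l (pair a b)) _))
              (sym (cong₂ _+_ (cong₂ _+_ (σ≡Σ _) (σ≡Σ _)) (σ≡Σ _))))))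
            (sym (trans (∑-distrib-+ (λ l → r l ⁅ a ⁆ + r l ⁅ b ⁆ + r l ⁅ c ⁆) _)
              (cong₂ _+_ (trans (∑-distrib-+ (λ l → r l ⁅ a ⁆ + r l ⁅ b ⁆) _)
                (cong₂ _+_ (Σ-pair a b) (sym (σ≡Σ _)))) (sym (σ≡Σ _)))))
            σ-surplus

        -- The case `x = y` is included, so the elements of `X p` are also non-loops.
        OneClass : Fin n → Fin k → Set
        OneClass p l = ∀ {x y} → x ∈ X p → y ∈ X p → Parallel (r l) x y

        -- Fix a pair `a`, `b` in `X p` and the summand `l` where it is parallel. Every element of
        -- `X p` turns out parallel to `a` in `l`, and transitivity through `a` does the rest. The
        -- index `q` serves to produce the pair.
        edge-summand : ∀ {p q} → p ≢ q → ∃[ l ] OneClass p l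
        edge-summand {p} p≢q with edge-pair p≢q
        ... | a , b , a≢b , a∈X , b∈X with Parallel-summand (σ-edge a≢b a∈X b∈X)
        ... | l , a∥b = l , λ {x} {y} x∈X y∈X →
            Parallel-trans (M l) {x} {a} {y} (Parallel-sym {r = r l} {a} {x} (a∥ x∈X)) (a∥ y∈X)
          where
          a∥ : ∀ {c} → c ∈ X p → Parallel (r l) a c
          a∥ {c} c∈X with a Finₚ.≟ c | b Finₚ.≟ c
          -- That `a` is a non-loop follows by going to `b` and back.
          ... | yes refl | _        =
            Parallel-trans (M l) {a} {b} {a} a∥b (Parallel-sym {r = r l} {a} {b} a∥b)
          ... | no _     | yes refl = a∥b
          ... | no a≢c   | no b≢c   =
            let l′ , ab , ac = triple-summand a≢b a≢c b≢c a∈X b∈X c∈X in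
            -- The summand found for the triple also has `a` and `b` parallel, so uniqueness
            -- identifies it with `l`.
            subst (λ h → Parallel (r h) a c)
              (Parallel-summand-unique a≢b a∈X b∈X ab a∥b) ac

        -- A common point of the two hyperedges links the separated points inside `l`. The defect
        -- carries over to `σ`, which has none on a separated pair.
        OneClass-injective : ∀ {p q} l → OneClass p l → OneClass q l → p ≡ q
        OneClass-injective {p} {q} l class-p class-q with p Finₚ.≟ q
        ... | yes p≡q = p≡q
        ... | no  p≢q =
          let a , b , a∈X , b∈X , separated = separation p q p≢q
              c , c∈ = proj₂ (complete p q p≢q)
              -- Distinctness is what `σ₂` asks for; equal points would both lie in `X p`.
              a≢b = λ a≡b →
                separated (p , pair⊆ a∈X (subst (_∈ X p) a≡b a∈X))
              a∥b = Parallel-summand⁻ {a} {b} l (Parallel-trans (M l) {a} {c} {b}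
                (class-p a∈X (p∩q⊆p (X p) (X q) c∈)) (class-q (p∩q⊆q (X p) (X q) c∈) b∈X))
          in contradiction a∥b (ℤₚ.≤⇒≯
               (subst₂ _≤_ (sym (cong₂ _+_ (σ₁ a) (σ₁ b))) (sym (σ₂ a≢b))
                 (hypergraphRank-separated separated)))

        -- The `n` hyperedges select distinct summands, each of which rises by at least one from `⊥`
        -- to `⊤`. The function `other` encodes that every hyperedge has a partner.
        n≤rank : (other : Fin n → Fin n) → (∀ p → p ≢ other p) → + n ≤ σ ⊤
        n≤rank other p≢other = begin
          + n                      ≡⟨ ℤₚ.+-identityˡ (+ n) ⟨
          0ℤ + + n                 ≡⟨ cong (_+ + n) (trans (sym (normalized P)) (σ≡Σ ⊥)) ⟩
          sum (λ l → r l ⊥) + + n  ≤⟨ sum-mono-injective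
                                        (λ l → monotone (r-isPolymatroid l) ⊥ ⊤ (λ _ → ∈⊤))
                                        (proj₁ ∘ class) class-injective class-rank ⟩
          sum (λ l → r l ⊤)        ≡⟨ σ≡Σ ⊤ ⟨
          σ ⊤                      ∎
          where
          open ≤-Reasoning
          class : ∀ p → ∃[ l ] OneClass p l
          class p = edge-summand (p≢other p)
          class-injective : Injective _≡_ _≡_ (proj₁ ∘ class)
          class-injective {p} {q} eq = OneClass-injective (proj₁ (class q))
            (subst (OneClass p) eq (proj₂ (class p))) (proj₂ (class q))
          class-rank : ∀ p → r (proj₁ (class p)) ⊥ < r (proj₁ (class p)) ⊤
          class-rank p =
            let a , a∈X = nonempty p
                l , ∥   = class p
            in nonloop (r-isPolymatroid l) {a} (∥ a∈X a∈X)

  -- Serves the case of a single hyperedge, which has no partner to be separated from.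
  rank≥1 : ∀ {σ} → IsPolymatroid σ → (∀ A → Small H A → σ A ≡ ρ A) → Fin n → 1ℤ ≤ σ ⊤
  rank≥1 {σ} P agree i with nonempty i
  ... | a , a∈X = begin
    1ℤ           ≤⟨ <⇒1+≤ 0<ρa ⟩
    ρ ⁅ a ⁆      ≡⟨ agree ⁅ a ⁆ (Small-singleton a) ⟨
    σ ⁅ a ⁆      ≤⟨ monotone P ⁅ a ⁆ ⊤ (λ _ → ∈⊤) ⟩
    σ ⊤          ∎
    where
    open ≤-Reasoning
    0<ρa : 0ℤ < ρ ⁅ a ⁆
    0<ρa = subst (_< ρ ⁅ a ⁆) (sum-replicate-zero n)
      (sum-mono-< (λ j → 0≤rank (hit-isPolymatroid j) ⁅ a ⁆) i
        (subst (0ℤ <_) (sym (hit-∈ (x∈⁅x⁆ a) a∈X)) (1+≤⇒< {0ℤ} ℤₚ.≤-refl)))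

-- Indecomposability of the polymatroid and of the truncations

indecomposable : ∀ {m n} (H : Hypergraph m n) → let X = Hypergraph.edge H in
  (∀ i j → i ≢ j → ∣ X i ∩ X j ∣ ℕ.≤ 1) → LineGraphComplete H →
  (∀ p q → p ≢ q → ∃[ a ] ∃[ b ] (a ∈ X p × b ∈ X q × ¬ (∃[ i ] pair a b ⊆ X i))) →
  ∀ {σ} → IsPolymatroid σ → (∀ A → Small H A → σ A ≡ hypergraphRank H A) →
  σ ⊤ < + n → Indecomposable σ
-- For `n` equal to 0 or 1 the assumed bound on `σ ⊤` already contradicts the lower bounds 0 and 1.
indecomposable {n = zero} H _ _ _ P _ σ<n _ = ℤₚ.<⇒≱ σ<n (0≤rank P ⊤)
indecomposable {n = suc zero} H _ _ _ P agree σ<n _ = ℤₚ.<⇒≱ σ<n (rank≥1 H P agree zero)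
indecomposable {n = suc (suc n)} H linear complete separation P agree σ<n (k , M , σ≡Σ) =
  ℤₚ.<⇒≱ σ<n (n≤rank H linear separation complete P agree M σ≡Σ
    -- With at least two hyperedges, `punchIn p zero` is an index other than `p`.
    (λ p → punchIn p zero) (λ p → ≢-sym (punchInᵢ≢i p zero)))

theorem2p15 :
    (m n : ℕ) (H : Hypergraph m n) →
    let X = Hypergraph.edge H
        ρ = hypergraphRank H
    in
    (∀ i j → i ≢ j → ∣ X i ∩ X j ∣ ℕ.≤ 1) →
    LineGraphComplete H →
    (∀ p q → p ≢ q →
      ∃[ a ] ∃[ b ] (a ∈ X p × b ∈ X q × ¬ (∃[ i ] (⁅ a ⁆ ∪ ⁅ b ⁆) ⊆ X i))) →
    ((σ : Subset m → ℤ) → IsPolymatroid σ →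
      (∀ A → Small H A → σ A ≡ ρ A) →
      σ ⊤ < + n →
      Indecomposable σ)
    ×
    ((s : ℤ) → maxSmallRank H ≤ s → s < + n →
      IsPolymatroid (truncate ρ s) × Indecomposable (truncate ρ s))
theorem2p15 m n H linear complete separation =
  (λ σ P → indecomposable H linear complete separation P) ,
  λ s max≤s s<n →
    let T = truncate-isPolymatroid (hypergraphRank-isPolymatroid H)
              (ℤₚ.≤-trans (0≤maxSmallRank H) max≤s)
    in T , indecomposable H linear complete separation T
         -- The cap leaves small sets unchanged, since their values are at most `s`, and it keeps
         -- the value on the ground set below `n`.
         (λ A small → ℤₚ.i≤j⇒i⊓j≡i (ℤₚ.≤-trans (Small⇒≤maxSmallRank H small) max≤s))
         (ℤₚ.≤-<-trans (ℤₚ.i⊓j≤j (hypergraphRank H ⊤) s) s<n)
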